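{- Let $N\ge 3$, $1\le r\le N$, and let $R$ be a set consisting of $r$ rim vertices of the wheel graph $W_{N+1}$ with central vertex $c$. Let $d_1,\ldots,d_r$ be the cyclic intervals of $R$. Then the number of rooted spanning forests of $W_{N+1}$ with root set $\{c\}\cup R$ is $$\mathcal F_{W_{N+1}}(\{c\}\cup R)=\prod_{i=1}^{r}F_{2d_i}.$$
   Context: The wheel graph $W_{N+1}$ ($N\ge3$) has vertex set $\{c,v_1,\ldots,v_N\}$ and edges $\{v_i,v_{i+1}\}$ (indices modulo $N$) and $\{c,v_i\}$ for $1\le i\le N$; $c$ is the central vertex and the $v_i$ are the rim vertices. For a set $R=\{v_{a_1},\ldots,v_{a_r}\}$ of rim vertices with $1\le a_1<\cdots<a_r\le N$, the cyclic intervals are $d_i=a_{i+1}-a_i$ for $1\le i\le r-1$ and $d_r=a_1+N-a_r$. For a finite connected graph $G$ and $\varnothing\ne S\subseteq V(G)$, a rooted spanning forest of $G$ with root set $S$ is a spanning forest (an acyclic subgraph containing all vertices of $G$) in which each connected component contains exactly one vertex of $S$; $\mathcal F_G(S)$ denotes the number of such forests. Fibonacci numbers: $F_0=0$, $F_1=1$, $F_{n+2}=F_{n+1}+F_n$. -}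

module Defs where

open import Data.Empty using (⊥-elim)
open import Data.Fin using (Fin; zero; suc; toℕ; splitAt)
open import Data.Fin.Properties using (toℕ-fromℕ<; toℕ<n; suc-injective; 0≢1+n; splitAt⁻¹-↑ˡ; splitAt⁻¹-↑ʳ)
open import Data.Fin.Subset using (Subset; _∈_; ⁅_⁆; _∪_; outside)
open import Data.Fin.Subset.Properties using (_∈?_)
open import Data.List using (List; []; _∷_; _++_; map; filter; allFin; length)
open import Data.List.Relation.Unary.Linked using (Linked)
open import Data.List.Relation.Unary.Unique.Propositional using (Unique)
open import Data.Nat using (ℕ; zero; suc; _+_; _∸_; _≥_; z≤n; s≤s; NonZero; >-nonZero; _<?_)
open import Data.Nat.DivMod using (_mod_; _%_; m<n⇒m%n≡m; n%n≡0)
open import Data.Nat.Properties using (≤-trans; ≤-antisym; ≮⇒≥; <-irrefl; <⇒≢; m≤n+m; n<1+n)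
open import Data.Product using (Σ; ∃; ∃!; _×_; _,_; proj₁; proj₂)
open import Data.Product.Properties using (,-injectiveˡ; ,-injectiveʳ)
open import Data.Sum using (_⊎_; inj₁; inj₂; [_,_]′)
open import Data.Vec using (_∷_)
open import Function using (_∘_)
open import Function.Bundles using (Inverse)
open import Level using (0ℓ)
open import Relation.Binary.Bundles using (Setoid)
open import Relation.Binary.Construct.Closure.ReflexiveTransitive using (Star)
import Relation.Binary.Construct.On as On
open import Relation.Binary.PropositionalEquality using (_≡_; _≢_; refl; sym; trans; cong; setoid)
open import Relation.Nullary using (¬_; yes; no)

fib : ℕ → ℕ
fib zero          = 0
fib (suc zero)    = 1
fib (suc (suc n)) = fib (suc n) + fib n

-- The edge e is the unordered pair {u , v}, where ends lists each edge once,
-- in an arbitrary orientation.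
Joins : ∀ {n m} → (Fin m → Fin n × Fin n) → Fin m → Fin n → Fin n → Set
Joins ends e u v = ends e ≡ (u , v) ⊎ ends e ≡ (v , u)

record Graph : Set where
  field
    order      : ℕ
    size       : ℕ
    ends       : Fin size → Fin order × Fin order
    loopless   : ∀ e v → ¬ Joins ends e v v
    noParallel : ∀ e f u v → Joins ends e u v → Joins ends f u v → e ≡ f

  Vertex : Set
  Vertex = Fin order

  -- A spanning subgraph contains all vertices, so it is given by its edge set.
  SpanningSubgraph : Set
  SpanningSubgraph = Subset size

  Adjacent : SpanningSubgraph → Vertex → Vertex → Set
  Adjacent T u v = ∃ λ e → e ∈ T × Joins ends e u v

  SameComponent : SpanningSubgraph → Vertex → Vertex → Set
  SameComponent T = Star (Adjacent T)

  -- The cycle visits v and then vs, in this order, before returning to v.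
  IsCycle : SpanningSubgraph → Vertex → List Vertex → Set
  IsCycle T v vs =
    length (v ∷ vs) ≥ 3 × Unique (v ∷ vs) × Linked (Adjacent T) (v ∷ vs ++ v ∷ [])

  Acyclic : SpanningSubgraph → Set
  Acyclic T = ∀ v vs → ¬ IsCycle T v vs

  -- Every component is the component of some vertex v.
  IsRootedSpanningForest : Subset order → SpanningSubgraph → Set
  IsRootedSpanningForest S T =
    Acyclic T × (∀ v → ∃! _≡_ λ s → s ∈ S × SameComponent T v s)

-- Forests are compared by their edge sets only, not by the accompanying proofs.
RootedSpanningForests : (G : Graph) → Subset (Graph.order G) → Setoid 0ℓ 0ℓ
RootedSpanningForests G S =
  On.setoid {B = Σ SpanningSubgraph (IsRootedSpanningForest S)} (setoid SpanningSubgraph) proj₁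
  where open Graph G

HasCardinality : Setoid 0ℓ 0ℓ → ℕ → Set
HasCardinality A k = Inverse (setoid (Fin k)) A

-- 𝓕 G [ S ]≐ k: the number of spanning forests of G with root set S is k.
𝓕_[_]≐_ : (G : Graph) → Subset (Graph.order G) → ℕ → Set
𝓕 G [ S ]≐ k = HasCardinality (RootedSpanningForests G S) k

-- The central vertex is zero; the rim vertex v_{j+1} is suc j for j : Fin N.
module Wheel (N : ℕ) (N≥3 : N ≥ 3) where

  private instance
    N≢0 : NonZero N
    N≢0 = >-nonZero (≤-trans (s≤s z≤n) N≥3)

  next : Fin N → Fin N
  next i = suc (toℕ i) mod N

  rimEnds spokeEnds : Fin N → Fin (suc N) × Fin (suc N)
  rimEnds i   = suc i , suc (next i)
  spokeEnds i = zero , suc i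

  wheelEnds : Fin (N + N) → Fin (suc N) × Fin (suc N)
  wheelEnds e = [ rimEnds , spokeEnds ]′ (splitAt N e)

  private
    next-cases : ∀ i → toℕ (next i) ≡ suc (toℕ i) ⊎ (suc (toℕ i) ≡ N × toℕ (next i) ≡ 0)
    next-cases i with suc (toℕ i) <? N
    ... | yes i+1<N = inj₁ (trans (toℕ-fromℕ< _) (m<n⇒m%n≡m i+1<N))
    ... | no  i+1≮N = inj₂ (i+1≡N , trans (toℕ-fromℕ< _) (trans (cong (_% N) i+1≡N) (n%n≡0 N)))
      where i+1≡N = ≤-antisym (toℕ<n i) (≮⇒≥ i+1≮N)

    N≢1 : 1 ≢ N
    N≢1 = <⇒≢ (≤-trans (s≤s (s≤s z≤n)) N≥3)

    N≢2 : 2 ≢ N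
    N≢2 = <⇒≢ N≥3

    next≢ : ∀ i → next i ≢ i
    next≢ i eq with next-cases i
    ... | inj₁ p       = <-irrefl (trans (sym (cong toℕ eq)) p) (n<1+n _)
    ... | inj₂ (p , q) = N≢1 (trans (cong suc (trans (sym q) (cong toℕ eq))) p)

    next²≢ : ∀ i j → next i ≡ j → next j ≢ i
    next²≢ i .(next i) refl eq with next-cases i | next-cases (next i)
    ... | inj₁ p | inj₁ q =
      <-irrefl (trans (sym (cong toℕ eq)) (trans q (cong suc p))) (m≤n+m (suc (toℕ i)) 1)
    ... | inj₁ p | inj₂ (q , q′) =
      N≢2 (trans (cong suc (trans (cong suc (trans (sym q′) (cong toℕ eq))) (sym p))) q)
    ... | inj₂ (p , p′) | inj₁ q =
      N≢2 (trans (cong suc (trans (cong suc (sym p′)) (trans (sym q) (cong toℕ eq)))) p)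
    ... | inj₂ (p , p′) | inj₂ (q , q′) = N≢1 (trans (cong suc (sym p′)) q)

    loopless : ∀ e v → ¬ Joins wheelEnds e v v
    loopless e v p with splitAt N e
    loopless e v (inj₁ q) | inj₁ i =
      next≢ i (suc-injective (trans (,-injectiveʳ q) (sym (,-injectiveˡ q))))
    loopless e v (inj₂ q) | inj₁ i =
      next≢ i (suc-injective (trans (,-injectiveʳ q) (sym (,-injectiveˡ q))))
    loopless e v (inj₁ q) | inj₂ i = 0≢1+n (trans (,-injectiveˡ q) (sym (,-injectiveʳ q)))
    loopless e v (inj₂ q) | inj₂ i = 0≢1+n (trans (,-injectiveˡ q) (sym (,-injectiveʳ q)))

    rim-unique : ∀ i j u v → (rimEnds i ≡ (u , v) ⊎ rimEnds i ≡ (v , u)) →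
                 (rimEnds j ≡ (u , v) ⊎ rimEnds j ≡ (v , u)) → i ≡ j
    rim-unique i j u v (inj₁ refl) (inj₁ q) = sym (suc-injective (,-injectiveˡ q))
    rim-unique i j u v (inj₁ refl) (inj₂ q) =
      ⊥-elim (next²≢ i j (sym (suc-injective (,-injectiveˡ q))) (suc-injective (,-injectiveʳ q)))
    rim-unique i j u v (inj₂ refl) (inj₁ q) =
      ⊥-elim (next²≢ i j (sym (suc-injective (,-injectiveˡ q))) (suc-injective (,-injectiveʳ q)))
    rim-unique i j u v (inj₂ refl) (inj₂ q) = sym (suc-injective (,-injectiveˡ q))

    noParallel : ∀ e f u v → Joins wheelEnds e u v → Joins wheelEnds f u v → e ≡ f
    noParallel e f u v p q with splitAt N e in eqe | splitAt N f in eqf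
    noParallel e f u v p q | inj₁ i | inj₁ j with rim-unique i j u v p q
    ... | refl = trans (sym (splitAt⁻¹-↑ˡ eqe)) (splitAt⁻¹-↑ˡ eqf)
    noParallel e f u v (inj₁ refl) (inj₁ ())   | inj₁ i | inj₂ j
    noParallel e f u v (inj₁ refl) (inj₂ ())   | inj₁ i | inj₂ j
    noParallel e f u v (inj₂ refl) (inj₁ ())   | inj₁ i | inj₂ j
    noParallel e f u v (inj₂ refl) (inj₂ ())   | inj₁ i | inj₂ j
    noParallel e f u v (inj₁ refl) (inj₁ ())   | inj₂ i | inj₁ j
    noParallel e f u v (inj₁ refl) (inj₂ ())   | inj₂ i | inj₁ j
    noParallel e f u v (inj₂ refl) (inj₁ ())   | inj₂ i | inj₁ j
    noParallel e f u v (inj₂ refl) (inj₂ ())   | inj₂ i | inj₁ j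
    noParallel e f u v (inj₁ refl) (inj₁ refl) | inj₂ i | inj₂ j =
      trans (sym (splitAt⁻¹-↑ʳ eqe)) (splitAt⁻¹-↑ʳ eqf)
    noParallel e f u v (inj₂ refl) (inj₂ refl) | inj₂ i | inj₂ j =
      trans (sym (splitAt⁻¹-↑ʳ eqe)) (splitAt⁻¹-↑ʳ eqf)
    noParallel e f u v (inj₁ refl) (inj₂ ())   | inj₂ i | inj₂ j
    noParallel e f u v (inj₂ refl) (inj₁ ())   | inj₂ i | inj₂ j

  wheel : Graph
  wheel = record
    { order      = suc N
    ; size       = N + N
    ; ends       = wheelEnds
    ; loopless   = loopless
    ; noParallel = noParallel
    }

open Wheel public using (wheel)

-- The vertex set {c} ∪ R of the wheel, for R a set of rim indices;
-- outside ∷ R is R as a set of vertices.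
center∪_ : ∀ {N} → Subset N → Subset (suc N)
center∪ R = ⁅ zero ⁆ ∪ (outside ∷ R)

-- The labels 1 ≤ a₁ < ⋯ < aᵣ ≤ N of the rim vertices in R.
rimLabels : ∀ {N} → Subset N → List ℕ
rimLabels {N} R = map (suc ∘ toℕ) (filter (_∈? R) (allFin N))

-- differences b (a ∷ a′ ∷ ⋯ ∷ z) is a′ ∸ a , … , b ∸ z.
differences : ℕ → List ℕ → List ℕ
differences b []            = []
differences b (a ∷ [])      = b ∸ a ∷ []
differences b (a ∷ a′ ∷ as) = a′ ∸ a ∷ differences b (a′ ∷ as)

-- d₁ , … , dᵣ for increasing labels a₁ , … , aᵣ in 1 .. N, so that no subtraction truncates.
intervals : ℕ → List ℕ → List ℕ
intervals N []        = []
intervals N (a₁ ∷ as) = differences (a₁ + N) (a₁ ∷ as)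

cyclicIntervals : ∀ {N} → Subset N → List ℕ
cyclicIntervals {N} R = intervals N (rimLabels R)

{-# OPTIONS --safe #-}
module Submission where

-- In a forest rooted at {c} ∪ R every other rim vertex points to its parent: the centre (spoke),
-- the next rim vertex (fwd) or the previous one (bwd). The only obstruction is a mutual pair
-- "fwd, bwd" on neighbouring vertices, since the vertices of R break the two circulations of the
-- rim. So the forests are the cyclic words over spoke, fwd, bwd, with R as fixed letters, avoiding
-- this pair. A transfer matrix counts them: d - 1 free letters between two vertices of R
-- contribute F_{2d}.

open import Defs
open import Data.Bool using (Bool; true; false; _∨_)
open import Data.Bool.Properties using (∨-zeroʳ)
open import Data.Empty using (⊥; ⊥-elim)
open import Data.Fin using (Fin; zero; suc; toℕ; fromℕ; inject₁; splitAt; _↑ˡ_; _↑ʳ_)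
open import Data.Fin.Induction using (<-weakInduction; >-weakInduction)
import Data.Fin.Properties as Fin
open import Data.Fin.Properties using (+↔⊎; 0↔⊥; 1↔⊤)
open import Data.Fin.Relation.Unary.Top using (view; ‵fromℕ; ‵inject₁)
open import Data.Fin.Subset using (Subset; _∈_; _∉_; _⊆_; _-_; ⁅_⁆; inside; outside; Nonempty; ∣_∣)
open import Data.Fin.Subset.Properties using (_∈?_; ⊆-antisym; x∈p∧x≢y⇒x∈p-y; p─q⊆p; drop-there;
  x∈p∪q⁻; x∈p∪q⁺; ∉⊥; nonempty?; Empty-unique; ∣⊥∣≡0)
open import Data.List using (List; []; _∷_; _++_; map; product; filter; allFin)
import Data.List as List
import Data.List.Membership.DecPropositional as DecMembership
open import Data.List.Membership.Propositional using () renaming (_∈_ to _∈ˡ_)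
open import Data.List.Properties using (map-tabulate; map-∘; map-cong)
open import Data.List.Relation.Unary.All using (All; []; _∷_; lookup)
open import Data.List.Relation.Unary.All.Properties using (¬Any⇒All¬)
open import Data.List.Relation.Unary.AllPairs using ([]; _∷_)
open import Data.List.Relation.Unary.Any using (here; there)
open import Data.List.Relation.Unary.Linked using (Linked; [-]; _∷_)
open import Data.List.Relation.Unary.Unique.Propositional using (Unique)
open import Data.Nat using (ℕ; zero; suc; z≤n; s≤s; _+_; _*_; _∸_; _≥_; _≤_)
open import Data.Nat.DivMod using (_%_; m<n⇒m%n≡m; n%n≡0)
open import Data.Nat.Properties using (+-suc; +-identityʳ; *-identityˡ; *-identityʳ; *-suc;
  +-comm; m+n∸m≡n)
open import Data.Nat.Tactic.RingSolver using (solve-∀)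
open import Data.Product using (∃; _×_; _,_; proj₁; proj₂; Σ)
open import Data.Sum using (_⊎_; inj₁; inj₂; swap; [_,_]′)
open import Data.Sum.Function.Propositional using (_⊎-↔_)
open import Data.Unit using (tt)
open import Data.Vec using (_∷_; there; []; here; tabulate)
open import Data.Vec.Properties using ([]=⇒lookup; lookup⇒[]=; lookup∘tabulate; tabulate-cong)
open import Function using (_∘_; _↔_; mk↔ₛ′; case_of_; Bijection)
open import Function.Construct.Composition using (inverse)
open import Function.Properties.Bijection using (Bijection⇒Inverse)
open import Function.Properties.Inverse using (↔-trans)
open import Relation.Binary.Construct.Closure.ReflexiveTransitive using (Star; ε; _◅_; _◅◅_;
  reverse) renaming (map to Star-map)
open import Relation.Binary.PropositionalEquality using (_≡_; _≢_; refl; sym; trans; cong; subst;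
  ≢-sym; cong₂; module ≡-Reasoning; _≗_; setoid)
open import Relation.Nullary using (¬_; yes; no; contradiction)

-- The delicate direction starts from a forest T known only as an acyclic edge set with unique
-- roots. The parent of a vertex u is read off as the second vertex of some simple path from u to
-- its root. Instead of the uniqueness of that path, only one trace of it is kept: the second vertex
-- still reaches the root set after the removal of any edge at u. This suffices to exclude mutual
-- pairs, since two neighbours that point to each other would be joined without their common edge.
-- The pointers therefore form an admissible word, whose own forest lies inside T; it is all of T,
-- because a proper subgraph of T leaves some vertex without a path to the root set. The count
-- becomes a product because a vertex of R forgets the state: its transfer matrix (1 0 ; 1 0) has
-- rank one, so the trace splits at the vertices of R. An interval d contributes the sum of the row
-- reached after d - 1 free letters, F_{2d-1} + F_{2d-2} = F_{2d}.

x∉p-x : ∀ {n} (p : Subset n) x → x ∉ p - x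
x∉p-x (_ ∷ p) (suc x) (there x∈) = x∉p-x p x x∈

-- Parent relations and rooted forests in an arbitrary graph.

module _ (G : Graph) where
  open Graph G
  open DecMembership (Fin._≟_ {order}) using () renaming (_∈?_ to _∈ˡ?_)

  Adjacent-sym : ∀ {T u v} → Adjacent T u v → Adjacent T v u
  Adjacent-sym (e , e∈T , j) = e , e∈T , swap j

  SameComponent-sym : ∀ {T u v} → SameComponent T u v → SameComponent T v u
  SameComponent-sym = reverse Adjacent-sym

  Adjacent-⊆ : ∀ {T T′ u v} → T ⊆ T′ → Adjacent T u v → Adjacent T′ u v
  Adjacent-⊆ T⊆T′ (e , e∈T , j) = e , T⊆T′ e∈T , j

  SameComponent-⊆ : ∀ {T T′ u v} → T ⊆ T′ → SameComponent T u v → SameComponent T′ u v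
  SameComponent-⊆ T⊆T′ = Star-map (Adjacent-⊆ T⊆T′)

  -- P x y says that y is the parent of x in a forest T rooted at S.
  record IsParentRelation (S : Subset order) (T : SpanningSubgraph) (P : Vertex → Vertex → Set) : Set where
    field
      functional : ∀ {x y z} → P x y → P x z → y ≡ z
      root       : ∀ {x y} → x ∈ S → ¬ P x y
      adjacent   : ∀ {x y} → P x y → Adjacent T x y
      oriented   : ∀ {x y} → Adjacent T x y → P x y ⊎ P y x
      reaches    : ∀ x → ∃ λ s → s ∈ S × Star P x s

    -- A loop through x runs through the only parent of x, so it can be rotated along the path to
    -- the root, until the root itself would have a parent.
    no-loop-above : ∀ {x y s} → s ∈ S → Star P x s → P x y → ¬ Star P y x
    no-loop-above s∈S ε Pxy _ = root s∈S Pxy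
    no-loop-above s∈S (Pxz ◅ ps) Pxy qs with functional Pxz Pxy
    no-loop-above s∈S (Pxz ◅ ps) Pxy ε          | refl = no-loop-above s∈S ps Pxy ε
    no-loop-above s∈S (Pxz ◅ ps) Pxy (Pyw ◅ qs) | refl = no-loop-above s∈S ps Pyw (qs ◅◅ (Pxy ◅ ε))

    no-loop : ∀ {x y} → P x y → ¬ Star P y x
    no-loop {x} with reaches x
    ... | _ , s∈S , ps = no-loop-above s∈S ps

    data NonBacktracking : List Vertex → Set where
      short : ∀ {x y} → NonBacktracking (x ∷ y ∷ [])
      _∷_   : ∀ {x y z xs} → x ≢ z → NonBacktracking (y ∷ z ∷ xs) → NonBacktracking (x ∷ y ∷ z ∷ xs)

    unique⇒nonBacktracking : ∀ {v x y} xs → Unique (x ∷ y ∷ xs) → All (v ≢_) (x ∷ y ∷ xs) →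
                             NonBacktracking (x ∷ y ∷ xs ++ v ∷ [])
    unique⇒nonBacktracking []       _ (v≢x ∷ _) = (≢-sym v≢x) ∷ short
    unique⇒nonBacktracking (z ∷ xs) ((_ ∷ x≢z ∷ _) ∷ u) (_ ∷ v≢) = x≢z ∷ unique⇒nonBacktracking xs u v≢

    -- A walk without backtracking that has moved to a child keeps moving to children.
    descend : ∀ {v x y} xs → P y x → Linked (Adjacent T) (y ∷ xs ++ v ∷ []) →
              NonBacktracking (x ∷ y ∷ xs ++ v ∷ []) → ∃ λ u → u ∈ˡ (y ∷ xs) × P v u × Star P u y
    descend {y = y} [] Pyx (Ayv ∷ _) (x≢v ∷ _) with oriented Ayv
    ... | inj₁ Pyv = ⊥-elim (x≢v (functional Pyx Pyv))
    ... | inj₂ Pvy = y , here refl , Pvy , ε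
    descend (z ∷ zs) Pyx (Ayz ∷ l) (x≢z ∷ nb) with oriented Ayz
    ... | inj₁ Pyz = ⊥-elim (x≢z (functional Pyx Pyz))
    ... | inj₂ Pzy with descend zs Pzy l nb
    ...   | u , u∈ , Pvu , ps = u , there u∈ , Pvu , ps ◅◅ (Pzy ◅ ε)

    -- By `descend`, a walk that turns downwards never turns up again: either it climbs all the way
    -- to v, or it arrives at v from the parent of v.
    ascend : ∀ {v x y} xs → P x y → Linked (Adjacent T) (y ∷ xs ++ v ∷ []) →
             NonBacktracking (x ∷ y ∷ xs ++ v ∷ []) →
             Star P y v ⊎ (∃ λ u → u ∈ˡ (y ∷ xs) × P v u)
    ascend {y = y} [] Pxy (Ayv ∷ _) _ with oriented Ayv
    ... | inj₁ Pyv = inj₁ (Pyv ◅ ε)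
    ... | inj₂ Pvy = inj₂ (y , here refl , Pvy)
    ascend (z ∷ zs) Pxy (Ayz ∷ l) (_ ∷ nb) with oriented Ayz
    ... | inj₂ Pzy = let u , u∈ , Pvu , _ = descend zs Pzy l nb in inj₂ (u , there u∈ , Pvu)
    ... | inj₁ Pyz with ascend zs Pyz l nb
    ...   | inj₁ ps              = inj₁ (Pyz ◅ ps)
    ...   | inj₂ (u , u∈ , Pvu) = inj₂ (u , there u∈ , Pvu)

    -- A cycle that only climbs or only descends is a loop of parents. One that climbs from v and
    -- later descends back to v makes both neighbours of v on it parents of v, although they are
    -- distinct.
    acyclic : Acyclic T
    acyclic v []           (s≤s () , _)
    acyclic v (_ ∷ [])     (s≤s (s≤s ()) , _)
    acyclic v (y ∷ z ∷ zs) (_ , v≢@(_ ∷ v≢z ∷ _) ∷ u@(y≢ ∷ _) , Avy ∷ l@(Ayz ∷ l′)) =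
      [ up , down ]′ (oriented Avy)
      where
      nb : NonBacktracking (y ∷ z ∷ zs ++ v ∷ [])
      nb = unique⇒nonBacktracking zs u v≢

      no-second-parent : P v y → ¬ (∃ λ u → u ∈ˡ (z ∷ zs) × P v u)
      no-second-parent Pvy (u , u∈ , Pvu) = lookup y≢ u∈ (functional Pvy Pvu)

      down : P y v → ⊥
      down Pyv = let _ , _ , Pvu , ps = descend (z ∷ zs) Pyv l (v≢z ∷ nb)
                 in no-loop Pyv (Pvu ◅ ps)

      up : P v y → ⊥
      -- The edge after y is examined before `ascend` is used, so that the vertex from which v is
      -- re-entered lies in `z ∷ zs` and differs from y.
      up Pvy with oriented Ayz
      ... | inj₂ Pzy = let u , u∈ , Pvu , _ = descend zs Pzy l′ nb in no-second-parent Pvy (u , u∈ , Pvu)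
      ... | inj₁ Pyz with ascend zs Pyz l′ nb
      ...   | inj₁ ps = no-loop Pvy (Pyz ◅ ps)
      ...   | inj₂ p  = no-second-parent Pvy p

    -- The path of parents to s survives every edge of the walk: an edge to a child prolongs it, an
    -- edge to the parent removes its first step.
    ancestral-root : ∀ {x y s} → SameComponent T x y → s ∈ S → Star P x s → Star P y s
    ancestral-root ε s∈S ps = ps
    ancestral-root (Axz ◅ as) s∈S ps with oriented Axz
    ... | inj₂ Pzx = ancestral-root as s∈S (Pzx ◅ ps)
    ancestral-root (Axz ◅ as) s∈S ε           | inj₁ Pxz = ⊥-elim (root s∈S Pxz)
    ancestral-root (Axz ◅ as) s∈S (Pxz′ ◅ ps) | inj₁ Pxz with functional Pxz Pxz′
    ... | refl = ancestral-root as s∈S ps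

    connected-roots-equal : ∀ {s s′} → s ∈ S → s′ ∈ S → SameComponent T s s′ → s ≡ s′
    connected-roots-equal s∈S s′∈S as with ancestral-root as s∈S ε
    ... | ε     = refl
    ... | p ◅ _ = ⊥-elim (root s′∈S p)

    isRootedSpanningForest : IsRootedSpanningForest S T
    isRootedSpanningForest = acyclic , λ v →
      let s , s∈S , ps = reaches v
          v∼s = Star-map adjacent ps
      in s , (s∈S , v∼s) , λ (s′∈S , v∼s′) →
           connected-roots-equal s∈S s′∈S (SameComponent-sym v∼s ◅◅ v∼s′)

  -- Induction on the P-path from x to its root. Were Q to orient the edge from y to x, then y would
  -- not be a root, its P-parent would by induction be its Q-parent x, and P would have the loop x,
  -- y, x.
  parent-unique : ∀ {S T P Q} → IsParentRelation S T P → IsParentRelation S T Q →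
                  ∀ {x y} → P x y → Q x y
  parent-unique {S} {T} {P} {Q} isP isQ {x} Pxy = let _ , s∈S , ps = P.reaches x in go s∈S ps Pxy
    where
    module P = IsParentRelation isP
    module Q = IsParentRelation isQ

    go : ∀ {x y s} → s ∈ S → Star P x s → P x y → Q x y
    go s∈S ε Pxy = ⊥-elim (P.root s∈S Pxy)
    go s∈S (Pxz ◅ ps) Pxy with P.functional Pxz Pxy
    ... | refl with Q.oriented (P.adjacent Pxy)
    ...   | inj₁ Qxy = Qxy
    go s∈S (Pxy ◅ ε) _ | refl | inj₂ Qyx = ⊥-elim (Q.root s∈S Qyx)
    go s∈S (Pxy ◅ ps@(Pyw ◅ _)) _ | refl | inj₂ Qyx with Q.functional Qyx (go s∈S ps Pyw)
    ... | refl = ⊥-elim (P.no-loop Pxy (Pyw ◅ ε))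

  -- Simple paths in a forest and the removal of edges.

  -- The list holds the vertices after the first one.
  data Path (T : SpanningSubgraph) : Vertex → List Vertex → Vertex → Set where
    []  : ∀ {u} → Path T u [] u
    _∷_ : ∀ {u x xs v} → Adjacent T u x → Path T x xs v → Path T u (x ∷ xs) v

  suffix : ∀ {T u x xs v} → u ∈ˡ (x ∷ xs) → Path T x xs v → Unique (x ∷ xs) →
           ∃ λ ys → Path T u ys v × Unique (u ∷ ys)
  suffix (here refl) p       un       = _ , p , un
  suffix (there u∈)  (a ∷ p) (_ ∷ un) = suffix u∈ p un

  simplePath : ∀ {T u v} → SameComponent T u v → ∃ λ xs → Path T u xs v × Unique (u ∷ xs)
  simplePath ε = [] , [] , [] ∷ []
  simplePath {u = u} (_◅_ {j = x} a as) with simplePath as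
  ... | xs , p , un with u ∈ˡ? (x ∷ xs)
  ...   | yes u∈ = suffix u∈ p un
  ...   | no  u∉ = x ∷ xs , a ∷ p , ¬Any⇒All¬ _ u∉ ∷ un

  path⇒linked : ∀ {T u xs v w} → Path T u xs v → Adjacent T v w → Linked (Adjacent T) (u ∷ xs ++ w ∷ [])
  path⇒linked []      a = a ∷ [-]
  path⇒linked (b ∷ p) a = b ∷ path⇒linked p a

  path-⊆ : ∀ {T T′ u xs v} → T ⊆ T′ → Path T u xs v → Path T′ u xs v
  path-⊆ T⊆T′ []      = []
  path-⊆ T⊆T′ (a ∷ p) = Adjacent-⊆ T⊆T′ a ∷ path-⊆ T⊆T′ p

  -- A simple path in T′ with at least two edges is closed by e to a cycle of T; a single edge would
  -- be parallel to e, hence e itself.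
  no-bypass : ∀ {T T′ e u v} → Acyclic T → T′ ⊆ T → e ∈ T → e ∉ T′ → Joins ends e u v →
              ¬ SameComponent T′ u v
  no-bypass {e = e} {u} acyclic T′⊆T e∈T e∉T′ j u∼v with simplePath u∼v
  ... | []         , []                    , _ = loopless e u j
  ... | _ ∷ []     , (f , f∈T′ , k) ∷ []   , _ = e∉T′ (subst (_∈ _) (noParallel f e _ _ k j) f∈T′)
  ... | xs@(_ ∷ _ ∷ _) , p , un =
    acyclic u xs (s≤s (s≤s (s≤s z≤n)) , un , path⇒linked (path-⊆ T′⊆T p) (e , e∈T , swap j))

  joins-end : ∀ {f a b u w} → Joins ends f a b → Joins ends f u w → u ≡ a ⊎ u ≡ b
  joins-end (inj₁ p) (inj₁ q) = inj₁ (sym (cong proj₁ (trans (sym p) q)))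
  joins-end (inj₁ p) (inj₂ q) = inj₂ (sym (cong proj₂ (trans (sym p) q)))
  joins-end (inj₂ p) (inj₁ q) = inj₂ (sym (cong proj₁ (trans (sym p) q)))
  joins-end (inj₂ p) (inj₂ q) = inj₁ (sym (cong proj₂ (trans (sym p) q)))

  -- An edge at u cannot occur on a path that misses u, so its removal leaves the path intact.
  path-avoiding : ∀ {T u w x xs v f} → All (u ≢_) (x ∷ xs) → Joins ends f u w →
                  Path T x xs v → SameComponent (T - f) x v
  path-avoiding _ j [] = ε
  path-avoiding (u≢x ∷ u≢@(u≢y ∷ _)) j ((g , g∈T , k) ∷ p) =
    (g , x∈p∧x≢y⇒x∈p-y g∈T g≢f , k) ◅ path-avoiding u≢ j p
    where
    g≢f : g ≢ _
    g≢f refl = [ u≢x , u≢y ]′ (joins-end k j)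

  -- The second vertex x of a simple path from u to its root has this property.
  Escapes : Subset order → SpanningSubgraph → Vertex → Vertex → Set
  Escapes S T u x = ∃ λ s → s ∈ S × (∀ f w → Joins ends f u w → SameComponent (T - f) x s)

  module _ {S : Subset order} {T : SpanningSubgraph} (forest : IsRootedSpanningForest S T) where

    same-root : ∀ {u v s s′} → s ∈ S → s′ ∈ S →
                SameComponent T u s → SameComponent T v s′ → SameComponent T u v → s ≡ s′
    same-root {u} s∈S s′∈S u∼s v∼s′ u∼v with proj₂ forest u
    ... | _ , _ , unique = trans (sym (unique (s∈S , u∼s))) (unique (s′∈S , u∼v ◅◅ v∼s′))

    escape : ∀ {u} → u ∉ S → ∃ λ x → Adjacent T u x × Escapes S T u x
    escape {u} u∉S with proj₂ forest u
    ... | s , (s∈S , u∼s) , _ with simplePath u∼s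
    ...   | []     , []    , _        = ⊥-elim (u∉S s∈S)
    ...   | x ∷ xs , a ∷ p , u≢ ∷ un = x , a , s , s∈S , λ f w j → path-avoiding u≢ j p

    -- Without f, v still reaches s and u still reaches s′. As f joins u to v in T, these roots
    -- coincide, so u and v are connected in `T - f`, which bypasses f.
    no-mutual-escape : ∀ {f u v} → f ∈ T → Joins ends f u v → Escapes S T u v → ¬ Escapes S T v u
    no-mutual-escape {f} {u} {v} f∈T j (s , s∈S , p) (s′ , s′∈S , q)
      with same-root s∈S s′∈S (SameComponent-⊆ T-f⊆T v∼s) (SameComponent-⊆ T-f⊆T u∼s′)
                     ((f , f∈T , swap j) ◅ ε)
      where
      T-f⊆T = p─q⊆p T ⁅ f ⁆
      v∼s = p f v j
      u∼s′ = q f u (swap j)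
    ... | refl = no-bypass (proj₁ forest) (p─q⊆p T ⁅ f ⁆) f∈T (x∉p-x T f) j
                   (q f u (swap j) ◅◅ SameComponent-sym (p f v j))

    -- The ends of an edge of T missing from T′ reach the same root within T′, so T′ would bypass
    -- that edge.
    spanning-⊆⇒≡ : ∀ {T′} → T′ ⊆ T → (∀ v → ∃ λ s → s ∈ S × SameComponent T′ v s) → T′ ≡ T
    spanning-⊆⇒≡ {T′} T′⊆T reaches = ⊆-antisym T′⊆T T⊆T′
      where
      T⊆T′ : T ⊆ T′
      T⊆T′ {e} e∈T with e ∈? T′
      ... | yes e∈T′ = e∈T′
      ... | no  e∉T′ with ends e in eq
      ...   | u , v with reaches u | reaches v
      ...     | s , s∈S , u∼s | s′ , s′∈S , v∼s′
        with same-root s∈S s′∈S (SameComponent-⊆ T′⊆T u∼s) (SameComponent-⊆ T′⊆T v∼s′)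
                       ((e , e∈T , inj₁ eq) ◅ ε)
      ...       | refl = ⊥-elim (no-bypass (proj₁ forest) T′⊆T e∈T e∉T′ (inj₁ eq)
                                   (u∼s ◅◅ SameComponent-sym v∼s′))

-- Words of parent pointers around the rim. The states before and after a letter tell
-- whether the preceding letter is fwd; bwd must not follow fwd.
data Word : ∀ {n} → Subset n → Bool → Bool → Set where
  []    : ∀ {s} → Word [] s s
  root  : ∀ {n} {R : Subset n} {s t} → Word R false t → Word (inside ∷ R) s t
  spoke : ∀ {n} {R : Subset n} {s t} → Word R false t → Word (outside ∷ R) s t
  fwd   : ∀ {n} {R : Subset n} {s t} → Word R true t → Word (outside ∷ R) s t
  bwd   : ∀ {n} {R : Subset n} {t} → Word R false t → Word (outside ∷ R) false t

-- Equality of the initial and final states imposes the condition on the last and the first rim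
-- vertex as well.
CyclicWord : ∀ {n} → Subset n → Set
CyclicWord R = Σ Bool λ s → Word R s s

count : ∀ {n} → Subset n → Bool → Bool → ℕ
count []            false false = 1
count []            false true  = 0
count []            true  false = 0
count []            true  true  = 1
count (inside ∷ R)  _     t     = count R false t
count (outside ∷ R) false t     = count R false t + (count R false t + count R true t)
count (outside ∷ R) true  t     = count R false t + count R true t

module Counts {n : ℕ} (R : Subset n) where
  ff ft tf tt′ : ℕ
  ff = count R false false
  ft = count R false true
  tf = count R true false
  tt′ = count R true true

count↔Word : ∀ {n} (R : Subset n) s t → Fin (count R s t) ↔ Word R s t
count↔Word [] false false = ↔-trans 1↔⊤ (mk↔ₛ′ (λ _ → []) (λ _ → tt) (λ { [] → refl }) λ _ → refl)
count↔Word [] false true  = ↔-trans 0↔⊥ (mk↔ₛ′ (λ ()) (λ ()) (λ ()) λ ())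
count↔Word [] true  false = ↔-trans 0↔⊥ (mk↔ₛ′ (λ ()) (λ ()) (λ ()) λ ())
count↔Word [] true  true  = ↔-trans 1↔⊤ (mk↔ₛ′ (λ _ → []) (λ _ → tt) (λ { [] → refl }) λ _ → refl)
count↔Word (inside ∷ R) s t = ↔-trans (count↔Word R false t)
  (mk↔ₛ′ root (λ { (root w) → w }) (λ { (root _) → refl }) λ _ → refl)
count↔Word (outside ∷ R) false t =
  ↔-trans +↔⊎ (↔-trans (count↔Word R false t ⊎-↔ ↔-trans +↔⊎ (count↔Word R false t ⊎-↔ count↔Word R true t))
    (mk↔ₛ′ (λ { (inj₁ w) → spoke w ; (inj₂ (inj₁ w)) → bwd w ; (inj₂ (inj₂ w)) → fwd w })
           (λ { (spoke w) → inj₁ w ; (bwd w) → inj₂ (inj₁ w) ; (fwd w) → inj₂ (inj₂ w) })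
           (λ { (spoke _) → refl ; (bwd _) → refl ; (fwd _) → refl })
           (λ { (inj₁ _) → refl ; (inj₂ (inj₁ _)) → refl ; (inj₂ (inj₂ _)) → refl })))
count↔Word (outside ∷ R) true t =
  ↔-trans +↔⊎ (↔-trans (count↔Word R false t ⊎-↔ count↔Word R true t)
    (mk↔ₛ′ (λ { (inj₁ w) → spoke w ; (inj₂ w) → fwd w })
           (λ { (spoke w) → inj₁ w ; (fwd w) → inj₂ w })
           (λ { (spoke _) → refl ; (fwd _) → refl })
           (λ { (inj₁ _) → refl ; (inj₂ _) → refl })))

-- The trace of the transfer matrix `count R`.
cyclicCount : ∀ {n} → Subset n → ℕ
cyclicCount R = count R false false + count R true true

cyclicCount↔CyclicWord : ∀ {n} (R : Subset n) → Fin (cyclicCount R) ↔ CyclicWord R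
cyclicCount↔CyclicWord R =
  ↔-trans +↔⊎ (↔-trans (count↔Word R false false ⊎-↔ count↔Word R true true)
    (mk↔ₛ′ (λ { (inj₁ w) → false , w ; (inj₂ w) → true , w })
           (λ { (false , w) → inj₁ w ; (true , w) → inj₂ w })
           (λ { (false , _) → refl ; (true , _) → refl })
           (λ { (inj₁ _) → refl ; (inj₂ _) → refl })))

-- The labels by the same recursion on R as `count`, so that both can be treated in one induction.
labelsFrom : ∀ {n} → ℕ → Subset n → List ℕ
labelsFrom k []            = []
labelsFrom k (inside ∷ R)  = k ∷ labelsFrom (suc k) R
labelsFrom k (outside ∷ R) = labelsFrom (suc k) R

filter-map-suc : ∀ {n} b (R : Subset n) xs →
                 filter (_∈? (b ∷ R)) (map suc xs) ≡ map suc (filter (_∈? R) xs)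
filter-map-suc b R [] = refl
filter-map-suc b R (x ∷ xs) with x ∈? R
... | yes _ = cong (suc x ∷_) (filter-map-suc b R xs)
... | no  _ = filter-map-suc b R xs

filter-allFin : ∀ {n} b (R : Subset n) →
                filter (_∈? (b ∷ R)) (List.tabulate suc) ≡ map suc (filter (_∈? R) (allFin n))
filter-allFin b R = trans (cong (filter (_∈? (b ∷ R))) (sym (map-tabulate (λ i → i) suc)))
                          (filter-map-suc b R (allFin _))

labelsFrom-filter : ∀ {n} k (R : Subset n) →
                    map (λ i → k + toℕ i) (filter (_∈? R) (allFin n)) ≡ labelsFrom k R
labelsFrom-filter k [] = refl
labelsFrom-filter {suc n} k (b ∷ R) with tail
  where
  tail : map (λ i → k + toℕ i) (filter (_∈? (b ∷ R)) (List.tabulate suc)) ≡ labelsFrom (suc k) R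
  tail = begin
    map (λ i → k + toℕ i) (filter (_∈? (b ∷ R)) (List.tabulate suc))
      ≡⟨ cong (map _) (filter-allFin b R) ⟩
    map (λ i → k + toℕ i) (map suc (filter (_∈? R) (allFin n)))
      ≡⟨ map-∘ (filter (_∈? R) (allFin n)) ⟨
    map (λ i → k + suc (toℕ i)) (filter (_∈? R) (allFin n))
      ≡⟨ map-cong (λ i → +-suc k (toℕ i)) (filter (_∈? R) (allFin n)) ⟩
    map (λ i → suc k + toℕ i) (filter (_∈? R) (allFin n))
      ≡⟨ labelsFrom-filter (suc k) R ⟩
    labelsFrom (suc k) R ∎
    where open ≡-Reasoning
labelsFrom-filter k (inside  ∷ R) | tail = cong₂ _∷_ (+-identityʳ k) tail
labelsFrom-filter k (outside ∷ R) | tail = tail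

rimLabels≡labelsFrom : ∀ {n} (R : Subset n) → rimLabels R ≡ labelsFrom 1 R
rimLabels≡labelsFrom = labelsFrom-filter 1

-- Fibonacci identities and the evaluation of the trace.

fib-+ : ∀ m n → fib (suc m) * fib (suc n) + fib m * fib n ≡ fib (suc (m + n))
fib-+ zero    n = trans (+-identityʳ _) (*-identityˡ _)
fib-+ (suc m) n = begin
  (fib (suc m) + fib m) * fib (suc n) + fib (suc m) * fib n
    ≡⟨ regroup (fib (suc m)) (fib m) (fib (suc n)) (fib n) ⟩
  fib (suc m) * fib (suc (suc n)) + fib m * fib (suc n)
    ≡⟨ fib-+ m (suc n) ⟩
  fib (suc (m + suc n))
    ≡⟨ cong (fib ∘ suc) (+-suc m n) ⟩
  fib (suc (suc m + n)) ∎
  where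
  open ≡-Reasoning
  regroup : ∀ a b c d → (a + b) * c + a * d ≡ a * (c + d) + b * c
  regroup = solve-∀

-- The row (F_{2m+1} , F_{2m}) counts the words on m free vertices starting in the state false,
-- by their final state: each free vertex sends (x , y) to (2x + y , x + y).
evenFib oddFib : ℕ → ℕ
evenFib m = fib (2 * m)
oddFib  m = fib (suc (2 * m))

evenFib-suc : ∀ m → evenFib (suc m) ≡ oddFib m + evenFib m
evenFib-suc m = cong fib (*-suc 2 m)

oddFib-suc : ∀ m → oddFib (suc m) ≡ 2 * oddFib m + evenFib m
oddFib-suc m = trans (cong (fib ∘ suc) (*-suc 2 m)) (regroup (oddFib m) (evenFib m))
  where
  regroup : ∀ x y → x + y + x ≡ 2 * x + y
  regroup = solve-∀

-- The interval that wraps around: m free vertices after the last root and j before the first one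
-- make an interval of length m + j + 1. The column (F_{2j+2} , F_{2j+1}) counts the words on the j
-- free vertices by their initial state.
evenFib-wrap : ∀ m j → oddFib m * evenFib (suc j) + evenFib m * oddFib j ≡ evenFib (suc (m + j))
evenFib-wrap m j = begin
  oddFib m * evenFib (suc j) + evenFib m * oddFib j
    ≡⟨ cong (λ i → oddFib m * fib i + evenFib m * oddFib j) (*-suc 2 j) ⟩
  oddFib m * fib (suc (suc (2 * j))) + evenFib m * oddFib j
    ≡⟨ fib-+ (2 * m) (suc (2 * j)) ⟩
  fib (suc (2 * m + suc (2 * j)))
    ≡⟨ cong fib (index m j) ⟩
  evenFib (suc (m + j)) ∎
  where
  open ≡-Reasoning
  index : ∀ m j → suc (2 * m + suc (2 * j)) ≡ 2 * suc (m + j)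
  index = solve-∀

-- The row (F_{2m+1} , F_{2m}) accounts for the m free vertices between the root labelled a and R,
-- the weights p and q of the final states for j free vertices after R.
count-after-root : ∀ {n} (R : Subset n) a m j →
  let p = evenFib (suc j) ; q = oddFib j in
  oddFib m * (count R false false * p + count R false true * q) +
  evenFib m * (count R true false * p + count R true true * q) ≡
  product (map evenFib (differences (a + suc (m + n + j)) (a ∷ labelsFrom (a + suc m) R)))
count-after-root [] a m j = begin
  oddFib m * (1 * p + 0 * q) + evenFib m * (0 * p + 1 * q) ≡⟨ regroup (oddFib m) (evenFib m) p q ⟩
  oddFib m * p + evenFib m * q                             ≡⟨ evenFib-wrap m j ⟩
  evenFib (suc (m + j))                                    ≡⟨ cong (λ i → evenFib (suc (i + j))) (+-identityʳ m) ⟨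
  evenFib (suc (m + 0 + j))                                ≡⟨ cong evenFib (m+n∸m≡n a (suc (m + 0 + j))) ⟨
  evenFib (a + suc (m + 0 + j) ∸ a)                        ≡⟨ *-identityʳ _ ⟨
  evenFib (a + suc (m + 0 + j) ∸ a) * 1                    ∎
  where
  open ≡-Reasoning
  p = evenFib (suc j)
  q = oddFib j
  regroup : ∀ x y p q → x * (1 * p + 0 * q) + y * (0 * p + 1 * q) ≡ x * p + y * q
  regroup = solve-∀
count-after-root {suc n} (outside ∷ R) a m j = begin
  oddFib m * ((ff + (ff + tf)) * p + (ft + (ft + tt′)) * q) + evenFib m * ((ff + tf) * p + (ft + tt′) * q)
    ≡⟨ regroup (oddFib m) (evenFib m) ff ft tf tt′ p q ⟩
  (2 * oddFib m + evenFib m) * (ff * p + ft * q) + (oddFib m + evenFib m) * (tf * p + tt′ * q)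
    ≡⟨ cong₂ (λ x y → x * (ff * p + ft * q) + y * (tf * p + tt′ * q)) (oddFib-suc m) (evenFib-suc m) ⟨
  oddFib (suc m) * (ff * p + ft * q) + evenFib (suc m) * (tf * p + tt′ * q)
    ≡⟨ count-after-root R a (suc m) j ⟩
  product (map evenFib (differences (a + suc (suc m + n + j)) (a ∷ labelsFrom (a + suc (suc m)) R)))
    ≡⟨ cong₂ (λ b k → product (map evenFib (differences b (a ∷ labelsFrom k R))))
         (cong (λ i → a + suc (i + j)) (sym (+-suc m n))) (+-suc a (suc m)) ⟩
  product (map evenFib (differences (a + suc (m + suc n + j)) (a ∷ labelsFrom (suc (a + suc m)) R))) ∎
  where
  open ≡-Reasoning
  open Counts R
  p = evenFib (suc j)
  q = oddFib j
  regroup : ∀ x y ff ft tf tt p q →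
    x * ((ff + (ff + tf)) * p + (ft + (ft + tt)) * q) + y * ((ff + tf) * p + (ft + tt) * q) ≡
    (2 * x + y) * (ff * p + ft * q) + (x + y) * (tf * p + tt * q)
  regroup = solve-∀
count-after-root {suc n} (inside ∷ R) a m j = begin
  oddFib m * (ff * p + ft * q) + evenFib m * (ff * p + ft * q)
    -- The root closes an interval of length m + 1, which contributes the row sum, and restarts the
    -- row at (1 , 0) = (`oddFib 0` , `evenFib 0`).
    ≡⟨ regroup (oddFib m) (evenFib m) (ff * p + ft * q) (tf * p + tt′ * q) ⟩
  (oddFib m + evenFib m) * (oddFib 0 * (ff * p + ft * q) + evenFib 0 * (tf * p + tt′ * q))
    ≡⟨ cong₂ _*_ (trans (sym (evenFib-suc m)) (cong evenFib (sym (m+n∸m≡n a (suc m)))))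
               (count-after-root R (a + suc m) 0 j) ⟩
  evenFib (a + suc m ∸ a) *
  product (map evenFib (differences (a + suc m + suc (n + j)) (a + suc m ∷ labelsFrom (a + suc m + 1) R)))
    ≡⟨ cong₂ (λ b k → evenFib (a + suc m ∸ a) * product (map evenFib (differences b (a + suc m ∷ labelsFrom k R))))
         (end a m n j) (+-comm (a + suc m) 1) ⟩
  evenFib (a + suc m ∸ a) *
  product (map evenFib (differences (a + suc (m + suc n + j)) (a + suc m ∷ labelsFrom (suc (a + suc m)) R))) ∎
  where
  open ≡-Reasoning
  open Counts R
  p = evenFib (suc j)
  q = oddFib j
  regroup : ∀ x y u v → x * u + y * u ≡ (x + y) * (1 * u + 0 * v)
  regroup = solve-∀
  end : ∀ a m n j → a + suc m + suc (n + j) ≡ a + suc (m + suc n + j)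
  end = solve-∀

-- The left-hand side is the trace of the transfer matrix for j free vertices followed by R: the
-- j-th power of the matrix of one free vertex is (F_{2j+1} F_{2j} ; F_{2j} F_{2j-1}), and z
-- stands for F_{2j-1}.
cyclicCount-from : ∀ {n} (R : Subset n) → Nonempty R → ∀ j z → oddFib j ≡ evenFib j + z →
  oddFib j * count R false false + evenFib j * (count R true false + count R false true) +
  z * count R true true ≡ product (map evenFib (intervals (j + n) (labelsFrom (suc j) R)))
cyclicCount-from {suc n} (inside ∷ R) _ j z z-def = begin
  x * ff + y * (ff + ft) + z * ft
    -- The cycle is cut at its first root, labelled j + 1. The j free vertices before it move to the
    -- end of the last interval, with weights p = x + y and q = y + z.
    ≡⟨ regroup x y z ff ft (tf * p + tt′ * q) ⟩
  1 * (ff * (x + y) + ft * (y + z)) + 0 * (tf * p + tt′ * q)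
    ≡⟨ cong₂ (λ u v → 1 * (ff * u + ft * v) + 0 * (tf * p + tt′ * q)) (evenFib-suc j) z-def ⟨
  1 * (ff * p + ft * q) + 0 * (tf * p + tt′ * q)
    ≡⟨ count-after-root R (suc j) 0 j ⟩
  product (map evenFib (differences (suc j + suc (n + j)) (suc j ∷ labelsFrom (suc j + 1) R)))
    ≡⟨ cong₂ (λ b k → product (map evenFib (differences b (suc j ∷ labelsFrom k R)))) (end j n) (+-comm (suc j) 1) ⟩
  product (map evenFib (differences (suc j + (j + suc n)) (suc j ∷ labelsFrom (suc (suc j)) R))) ∎
  where
  open ≡-Reasoning
  open Counts R
  x = oddFib j
  y = evenFib j
  p = evenFib (suc j)
  q = oddFib j
  regroup : ∀ x y z ff ft v → x * ff + y * (ff + ft) + z * ft ≡ 1 * (ff * (x + y) + ft * (y + z)) + 0 * v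
  regroup = solve-∀
  end : ∀ j n → suc j + suc (n + j) ≡ suc j + (j + suc n)
  end = solve-∀
cyclicCount-from {suc n} (outside ∷ R) (suc i , there i∈R) j z z-def = begin
  x * (ff + (ff + tf)) + y * ((ff + tf) + (ft + (ft + tt′))) + z * (ft + tt′)
    ≡⟨ regroup x y z ff ft tf tt′ ⟩
  (2 * x + y) * ff + ((x + y) * tf + (y + (y + z)) * ft) + (y + z) * tt′
    ≡⟨ cong (λ u → (2 * x + y) * ff + ((x + y) * tf + (y + u) * ft) + u * tt′) z-def ⟨
  (2 * x + y) * ff + ((x + y) * tf + (y + x) * ft) + x * tt′
    ≡⟨ regroup′ x y ff ft tf tt′ ⟩
  (2 * x + y) * ff + (x + y) * (tf + ft) + x * tt′
    ≡⟨ cong₂ (λ u v → u * ff + v * (tf + ft) + x * tt′) (oddFib-suc j) (evenFib-suc j) ⟨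
  oddFib (suc j) * ff + evenFib (suc j) * (tf + ft) + x * tt′
    -- With j + 1 in place of j, the entry z becomes F_{2j+1}, which is x.
    ≡⟨ cyclicCount-from R (i , i∈R) (suc j) x z-suc ⟩
  product (map evenFib (intervals (suc j + n) (labelsFrom (suc (suc j)) R)))
    ≡⟨ cong (λ N → product (map evenFib (intervals N (labelsFrom (suc (suc j)) R)))) (sym (+-suc j n)) ⟩
  product (map evenFib (intervals (j + suc n) (labelsFrom (suc (suc j)) R))) ∎
  where
  open ≡-Reasoning
  open Counts R
  x = oddFib j
  y = evenFib j
  regroup : ∀ x y z ff ft tf tt →
    x * (ff + (ff + tf)) + y * ((ff + tf) + (ft + (ft + tt))) + z * (ft + tt) ≡
    (2 * x + y) * ff + ((x + y) * tf + (y + (y + z)) * ft) + (y + z) * tt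
  regroup = solve-∀
  regroup′ : ∀ x y ff ft tf tt →
    (2 * x + y) * ff + ((x + y) * tf + (y + x) * ft) + x * tt ≡
    (2 * x + y) * ff + (x + y) * (tf + ft) + x * tt
  regroup′ = solve-∀
  swap-double : ∀ x y → 2 * x + y ≡ (x + y) + x
  swap-double = solve-∀
  z-suc : oddFib (suc j) ≡ evenFib (suc j) + x
  z-suc = trans (oddFib-suc j) (trans (swap-double x y) (cong (_+ x) (sym (evenFib-suc j))))

cyclicCount≡product : ∀ {n} (R : Subset n) → Nonempty R →
                      cyclicCount R ≡ product (map evenFib (cyclicIntervals R))
cyclicCount≡product {n} R R≢∅ = begin
  ff + tt′                         ≡⟨ regroup ff tt′ (tf + ft) ⟩
  1 * ff + 0 * (tf + ft) + 1 * tt′ ≡⟨ cyclicCount-from R R≢∅ 0 1 refl ⟩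
  product (map evenFib (intervals n (labelsFrom 1 R)))
    ≡⟨ cong (λ as → product (map evenFib (intervals n as))) (rimLabels≡labelsFrom R) ⟨
  product (map evenFib (cyclicIntervals R)) ∎
  where
  open ≡-Reasoning
  open Counts R
  regroup : ∀ a b c → a + b ≡ 1 * a + 0 * c + 1 * b
  regroup = solve-∀

-- Words as functions on the rim.

data Letter : Set where
  root spoke fwd bwd : Letter

isFwd isBwd isSpoke : Letter → Bool
isFwd fwd = true
isFwd _   = false
isBwd bwd = true
isBwd _   = false
isSpoke spoke = true
isSpoke _     = false

isFwd⇒fwd : ∀ {x} → isFwd x ≡ true → x ≡ fwd
isFwd⇒fwd {fwd} _ = refl

isBwd⇒bwd : ∀ {x} → isBwd x ≡ true → x ≡ bwd
isBwd⇒bwd {bwd} _ = refl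

isSpoke⇒spoke : ∀ {x} → isSpoke x ≡ true → x ≡ spoke
isSpoke⇒spoke {spoke} _ = refl

≢fwd⇒¬isFwd : ∀ {x} → x ≢ fwd → isFwd x ≡ false
≢fwd⇒¬isFwd {root}  _ = refl
≢fwd⇒¬isFwd {spoke} _ = refl
≢fwd⇒¬isFwd {fwd}   x≢fwd = ⊥-elim (x≢fwd refl)
≢fwd⇒¬isFwd {bwd}   _ = refl

letter : ∀ {n} {R : Subset n} {s t} → Word R s t → Fin n → Letter
letter (root w)  zero    = root
letter (spoke w) zero    = spoke
letter (fwd w)   zero    = fwd
letter (bwd w)   zero    = bwd
letter (root w)  (suc i) = letter w i
letter (spoke w) (suc i) = letter w i
letter (fwd w)   (suc i) = letter w i
letter (bwd w)   (suc i) = letter w i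

letter-injective : ∀ {n} {R : Subset n} {s t} (w w′ : Word R s t) → letter w ≗ letter w′ → w ≡ w′
letter-injective []        []         _  = refl
letter-injective (root w)  (root w′)  eq = cong root (letter-injective w w′ (eq ∘ suc))
letter-injective (spoke w) (spoke w′) eq = cong spoke (letter-injective w w′ (eq ∘ suc))
letter-injective (fwd w)   (fwd w′)   eq = cong fwd (letter-injective w w′ (eq ∘ suc))
letter-injective (bwd w)   (bwd w′)   eq = cong bwd (letter-injective w w′ (eq ∘ suc))
letter-injective (spoke w) (fwd w′)   eq with () ← eq zero
letter-injective (spoke w) (bwd w′)   eq with () ← eq zero
letter-injective (fwd w)   (spoke w′) eq with () ← eq zero
letter-injective (fwd w)   (bwd w′)   eq with () ← eq zero
letter-injective (bwd w)   (spoke w′) eq with () ← eq zero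
letter-injective (bwd w)   (fwd w′)   eq with () ← eq zero

letter-root : ∀ {n} {R : Subset n} {s t} (w : Word R s t) {i} → letter w i ≡ root → i ∈ R
letter-root (root w)  {zero}  _  = here
letter-root (root w)  {suc i} eq = there (letter-root w eq)
letter-root (spoke w) {suc i} eq = there (letter-root w eq)
letter-root (fwd w)   {suc i} eq = there (letter-root w eq)
letter-root (bwd w)   {suc i} eq = there (letter-root w eq)

root-letter : ∀ {n} {R : Subset n} {s t} (w : Word R s t) {i} → i ∈ R → letter w i ≡ root
root-letter (root w)  here       = refl
root-letter (root w)  (there i∈) = root-letter w i∈
root-letter (spoke w) (there i∈) = root-letter w i∈
root-letter (fwd w)   (there i∈) = root-letter w i∈
root-letter (bwd w)   (there i∈) = root-letter w i∈

-- There are n + 1 states for n letters: index `zero` is the initial state and `fromℕ n` the final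
-- one.
stateBefore : ∀ {n} → Bool → (Fin n → Letter) → Fin (suc n) → Bool
stateBefore s ℓ zero    = s
stateBefore s ℓ (suc i) = isFwd (ℓ i)

stateBefore-suc : ∀ {n} (ℓ : Fin (suc n) → Letter) i →
                  stateBefore (isFwd (ℓ zero)) (ℓ ∘ suc) i ≡ isFwd (ℓ i)
stateBefore-suc ℓ zero    = refl
stateBefore-suc ℓ (suc i) = refl

letter-last : ∀ {n} {R : Subset n} {s t} (w : Word R s t) → stateBefore s (letter w) (fromℕ n) ≡ t
letter-last []                  = refl
letter-last {s = s} w@(root v)  = trans (sym (stateBefore-suc (letter {s = s} w) (fromℕ _))) (letter-last v)
letter-last {s = s} w@(spoke v) = trans (sym (stateBefore-suc (letter {s = s} w) (fromℕ _))) (letter-last v)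
letter-last {s = s} w@(fwd v)   = trans (sym (stateBefore-suc (letter {s = s} w) (fromℕ _))) (letter-last v)
letter-last w@(bwd v)           = trans (sym (stateBefore-suc (letter w) (fromℕ _))) (letter-last v)

letter-bwd : ∀ {n} {R : Subset n} {s t} (w : Word R s t) i → letter w i ≡ bwd →
             stateBefore s (letter w) (inject₁ i) ≡ false
letter-bwd (bwd _) zero _ = refl
letter-bwd {s = s} w@(root v)  (suc i) eq =
  trans (sym (stateBefore-suc (letter {s = s} w) (inject₁ i))) (letter-bwd v i eq)
letter-bwd {s = s} w@(spoke v) (suc i) eq =
  trans (sym (stateBefore-suc (letter {s = s} w) (inject₁ i))) (letter-bwd v i eq)
letter-bwd {s = s} w@(fwd v)   (suc i) eq =
  trans (sym (stateBefore-suc (letter {s = s} w) (inject₁ i))) (letter-bwd v i eq)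
letter-bwd w@(bwd v)           (suc i) eq =
  trans (sym (stateBefore-suc (letter w) (inject₁ i))) (letter-bwd v i eq)

prepend : ∀ {n b x s t} {R : Subset n} → (x ≡ root → zero ∈ b ∷ R) → (zero ∈ b ∷ R → x ≡ root) →
          (x ≡ bwd → s ≡ false) → (w : Word R (isFwd x) t) →
          Σ (Word (b ∷ R) s t) λ w′ → letter w′ zero ≡ x × letter w′ ∘ suc ≗ letter w
prepend {b = inside} {root}  _ _ _ w = root w , refl , λ _ → refl
prepend {b = inside} {spoke} _ r _ w with () ← r here
prepend {b = inside} {fwd}   _ r _ w with () ← r here
prepend {b = inside} {bwd}   _ r _ w with () ← r here
prepend {b = outside} {root}  r _ _ w with () ← r refl
prepend {b = outside} {spoke} _ _ _ w = spoke w , refl , λ _ → refl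
prepend {b = outside} {fwd}   _ _ _ w = fwd w , refl , λ _ → refl
prepend {b = outside} {bwd}   _ _ p w with refl ← p refl = bwd w , refl , λ _ → refl

spell : ∀ {n} (R : Subset n) ℓ s {t} → (∀ i → ℓ i ≡ root → i ∈ R) → (∀ i → i ∈ R → ℓ i ≡ root) →
        (∀ i → ℓ i ≡ bwd → stateBefore s ℓ (inject₁ i) ≡ false) → stateBefore s ℓ (fromℕ n) ≡ t →
        Σ (Word R s t) λ w → letter w ≗ ℓ
spell []      ℓ s _ _ _ refl = [] , λ ()
spell (b ∷ R) ℓ s r r′ p end =
  let w , w≗ = spell R (ℓ ∘ suc) (isFwd (ℓ zero)) (λ i → drop-there ∘ r (suc i)) (λ i → r′ (suc i) ∘ there)
                 (λ i eq → trans (stateBefore-suc ℓ (inject₁ i)) (p (suc i) eq))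
                 (trans (stateBefore-suc ℓ (fromℕ _)) end)
      w′ , eq₀ , eq = prepend (r zero) (r′ zero) (p zero) w
  in w′ , λ { zero → eq₀ ; (suc i) → trans (eq i) (w≗ i) }

∈-tabulate⁺ : ∀ {n} (f : Fin n → Bool) {i} → f i ≡ true → i ∈ tabulate f
∈-tabulate⁺ f {i} eq = lookup⇒[]= i _ (trans (lookup∘tabulate f i) eq)

∈-tabulate⁻ : ∀ {n} (f : Fin n → Bool) {i} → i ∈ tabulate f → f i ≡ true
∈-tabulate⁻ f {i} i∈ = trans (sym (lookup∘tabulate f i)) ([]=⇒lookup i∈)

-- The wheel: its rim, its edges and the subgraph of a word.

module _ (n : ℕ) (N≥3 : suc n ≥ 3) where
  open Wheel (suc n) N≥3 hiding (wheel)
  private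
    N = suc n
    W = wheel N N≥3
  open Graph W

  next-inject₁ : ∀ i → next (inject₁ i) ≡ suc i
  next-inject₁ i = Fin.toℕ-injective (trans (Fin.toℕ-fromℕ< _)
    (trans (cong (λ k → suc k % N) (Fin.toℕ-inject₁ i)) (m<n⇒m%n≡m (s≤s (Fin.toℕ<n i)))))

  next-fromℕ : next (fromℕ n) ≡ zero
  next-fromℕ = Fin.toℕ-injective (trans (Fin.toℕ-fromℕ< _)
    (trans (cong (λ k → suc k % N) (Fin.toℕ-fromℕ n)) (n%n≡0 N)))

  next-injective : ∀ {i j} → next i ≡ next j → i ≡ j
  next-injective {i} {j} eq with view i | view j
  ... | ‵fromℕ     | ‵fromℕ     = refl
  ... | ‵fromℕ     | ‵inject₁ j′ with () ← trans (sym next-fromℕ) (trans eq (next-inject₁ j′))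
  next-injective eq | ‵inject₁ i′ | ‵fromℕ with () ← trans (sym (next-inject₁ i′)) (trans eq next-fromℕ)
  next-injective eq | ‵inject₁ i′ | ‵inject₁ j′ =
    cong inject₁ (Fin.suc-injective (trans (sym (next-inject₁ i′)) (trans eq (next-inject₁ j′))))

  prev : ∀ i → ∃ λ j → next j ≡ i
  prev zero    = fromℕ n , next-fromℕ
  prev (suc i) = inject₁ i , next-inject₁ i

  -- The route through the last and the first rim vertex may be longer than necessary, but it avoids
  -- a comparison of i with j.
  cyclic : ∀ i j → Star (λ i j → next i ≡ j) i j
  cyclic i j = to-last i ◅◅ (next-fromℕ ◅ from-zero j)
    where
    from-zero : ∀ j → Star (λ i j → next i ≡ j) zero j
    from-zero = <-weakInduction _ ε λ j p → p ◅◅ (next-inject₁ j ◅ ε)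
    to-last : ∀ i → Star (λ i j → next i ≡ j) i (fromℕ n)
    to-last = >-weakInduction _ ε λ i p → next-inject₁ i ◅ p

  joins-rim : ∀ i → Joins wheelEnds (i ↑ˡ N) (suc i) (suc (next i))
  joins-rim i rewrite Fin.splitAt-↑ˡ N i N = inj₁ refl

  joins-spoke : ∀ i → Joins wheelEnds (N ↑ʳ i) (suc i) zero
  joins-spoke i rewrite Fin.splitAt-↑ʳ N N i = inj₂ refl

  -- Keeps the two rim neighbours of a vertex distinct, so that a parent determines its letter.
  -- Otherwise the rim edges leaving i and `next i` would be parallel, hence equal, and a loop.
  next²≢ : ∀ i → next (next i) ≢ i
  next²≢ i eq = loopless (i ↑ˡ N) (suc i)
    (subst (λ j → Joins wheelEnds (i ↑ˡ N) (suc i) (suc j)) next≡ (joins-rim i))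
    where
    same-edge : i ↑ˡ N ≡ next i ↑ˡ N
    same-edge = noParallel _ _ _ _ (joins-rim i)
      (swap (subst (λ j → Joins wheelEnds (next i ↑ˡ N) (suc (next i)) (suc j)) eq (joins-rim (next i))))
    next≡ : next i ≡ i
    next≡ = sym (Fin.↑ˡ-injective N _ _ same-edge)

  data EdgeView : Fin (N + N) → Set where
    rim   : (i : Fin N) → EdgeView (i ↑ˡ N)
    spoke : (i : Fin N) → EdgeView (N ↑ʳ i)

  edgeView : ∀ e → EdgeView e
  edgeView e with splitAt N e in eq
  ... | inj₁ i = subst EdgeView (Fin.splitAt⁻¹-↑ˡ eq) (rim i)
  ... | inj₂ i = subst EdgeView (Fin.splitAt⁻¹-↑ʳ eq) (spoke i)

  rim-ends : ∀ i {u v} → Joins wheelEnds (i ↑ˡ N) u v →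
             (u ≡ suc i × v ≡ suc (next i)) ⊎ (u ≡ suc (next i) × v ≡ suc i)
  rim-ends i j rewrite Fin.splitAt-↑ˡ N i N with j
  ... | inj₁ refl = inj₁ (refl , refl)
  ... | inj₂ refl = inj₂ (refl , refl)

  spoke-ends : ∀ i {u v} → Joins wheelEnds (N ↑ʳ i) u v →
               (u ≡ zero × v ≡ suc i) ⊎ (u ≡ suc i × v ≡ zero)
  spoke-ends i j rewrite Fin.splitAt-↑ʳ N N i with j
  ... | inj₁ refl = inj₁ (refl , refl)
  ... | inj₂ refl = inj₂ (refl , refl)

  center∈ : ∀ {R : Subset N} → zero ∈ center∪ R
  center∈ = here

  rim∈⁺ : ∀ {R : Subset N} {i} → i ∈ R → suc i ∈ center∪ R
  rim∈⁺ {R} i∈R = x∈p∪q⁺ {p = ⁅ zero ⁆} {q = outside ∷ R} (inj₂ (there i∈R))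

  rim∈⁻ : ∀ {R : Subset N} {i} → suc i ∈ center∪ R → i ∈ R
  rim∈⁻ {R} i∈ with x∈p∪q⁻ _ (outside ∷ R) i∈
  ... | inj₁ (there i∈⊥) = ⊥-elim (∉⊥ i∈⊥)
  ... | inj₂ (there i∈R) = i∈R

  data Parent (ℓ : Fin N → Letter) : Vertex → Vertex → Set where
    spoke : ∀ {i} → ℓ i ≡ spoke → Parent ℓ (suc i) zero
    fwd   : ∀ {i j} → ℓ i ≡ fwd → next i ≡ j → Parent ℓ (suc i) (suc j)
    bwd   : ∀ {i j} → ℓ i ≡ bwd → next j ≡ i → Parent ℓ (suc i) (suc j)

  edgeBit : (Fin N → Letter) → Fin N ⊎ Fin N → Bool
  edgeBit ℓ (inj₁ i) = isFwd (ℓ i) ∨ isBwd (ℓ (next i))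
  edgeBit ℓ (inj₂ i) = isSpoke (ℓ i)

  edgeSet : (Fin N → Letter) → SpanningSubgraph
  edgeSet ℓ = tabulate (edgeBit ℓ ∘ splitAt N)

  rim∈edgeSet⁻ : ∀ ℓ i → i ↑ˡ N ∈ edgeSet ℓ → ℓ i ≡ fwd ⊎ ℓ (next i) ≡ bwd
  rim∈edgeSet⁻ ℓ i i∈ with ∈-tabulate⁻ (edgeBit ℓ ∘ splitAt N) i∈
  ... | bit rewrite Fin.splitAt-↑ˡ N i N with isFwd (ℓ i) in eq
  ...   | true  = inj₁ (isFwd⇒fwd eq)
  ...   | false = inj₂ (isBwd⇒bwd bit)

  spoke∈edgeSet⁻ : ∀ ℓ i → N ↑ʳ i ∈ edgeSet ℓ → ℓ i ≡ spoke
  spoke∈edgeSet⁻ ℓ i i∈ with ∈-tabulate⁻ (edgeBit ℓ ∘ splitAt N) i∈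
  ... | bit rewrite Fin.splitAt-↑ʳ N N i = isSpoke⇒spoke bit

  fwd⇒∈edgeSet : ∀ ℓ i → ℓ i ≡ fwd → i ↑ˡ N ∈ edgeSet ℓ
  fwd⇒∈edgeSet ℓ i eq = ∈-tabulate⁺ (edgeBit ℓ ∘ splitAt N)
    (trans (cong (edgeBit ℓ) (Fin.splitAt-↑ˡ N i N)) (cong (λ x → isFwd x ∨ isBwd (ℓ (next i))) eq))

  bwd⇒∈edgeSet : ∀ ℓ i → ℓ (next i) ≡ bwd → i ↑ˡ N ∈ edgeSet ℓ
  bwd⇒∈edgeSet ℓ i eq = ∈-tabulate⁺ (edgeBit ℓ ∘ splitAt N)
    (trans (cong (edgeBit ℓ) (Fin.splitAt-↑ˡ N i N))
      (trans (cong (λ x → isFwd (ℓ i) ∨ isBwd x) eq) (∨-zeroʳ (isFwd (ℓ i)))))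

  spoke⇒∈edgeSet : ∀ ℓ i → ℓ i ≡ spoke → N ↑ʳ i ∈ edgeSet ℓ
  spoke⇒∈edgeSet ℓ i eq = ∈-tabulate⁺ (edgeBit ℓ ∘ splitAt N)
    (trans (cong (edgeBit ℓ) (Fin.splitAt-↑ʳ N N i)) (cong isSpoke eq))

  record Valid (R : Subset N) (ℓ : Fin N → Letter) : Set where
    field
      root⇒∈  : ∀ i → ℓ i ≡ root → i ∈ R
      ∈⇒root  : ∀ i → i ∈ R → ℓ i ≡ root
      noClash : ∀ i → ℓ i ≡ fwd → ℓ (next i) ≢ bwd

  letter-valid : ∀ {R s} (w : Word R s s) → Valid R (letter w)
  letter-valid {s = s} w = record
    { root⇒∈ = λ _ → letter-root w ; ∈⇒root = λ _ → root-letter w ; noClash = noClash }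
    where
    noClash : ∀ i → letter w i ≡ fwd → letter w (next i) ≢ bwd
    noClash i is-fwd is-bwd with view i
    ... | ‵inject₁ j with () ← trans (sym (cong isFwd is-fwd))
                         (letter-bwd w (suc j) (subst (λ k → letter w k ≡ bwd) (next-inject₁ j) is-bwd))
    -- At the wrap-around the final state, set by the last letter, is the initial state s, and a
    -- `bwd` on the first vertex forces s to be `false`.
    noClash i is-fwd is-bwd | ‵fromℕ
      with () ← trans (sym (cong isFwd is-fwd))
                  (trans (letter-last w) (letter-bwd w zero (subst (λ k → letter w k ≡ bwd) next-fromℕ is-bwd)))

  valid-spell : ∀ {R ℓ} → Valid R ℓ → Σ (CyclicWord R) λ (_ , w) → letter w ≗ ℓ
  valid-spell {R} {ℓ} valid = let w , w≗ℓ = spell R ℓ s root⇒∈ ∈⇒root bwd-after refl in (s , w) , w≗ℓ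
    where
    open Valid valid
    -- The initial state is dictated by the last vertex, the cyclic predecessor of the first.
    s = isFwd (ℓ (fromℕ n))
    not-fwd : ∀ {i j} → next i ≡ j → ℓ j ≡ bwd → isFwd (ℓ i) ≡ false
    not-fwd refl is-bwd = ≢fwd⇒¬isFwd λ is-fwd → noClash _ is-fwd is-bwd
    bwd-after : ∀ i → ℓ i ≡ bwd → stateBefore s ℓ (inject₁ i) ≡ false
    bwd-after zero    = not-fwd next-fromℕ
    bwd-after (suc i) = not-fwd (next-inject₁ i)

  -- The last letter determines the state, so nothing is lost in passing from a cyclic word to its
  -- letters.
  cyclicWord-injective : ∀ {R : Subset N} ((_ , w) (_ , w′) : CyclicWord R) → letter w ≗ letter w′ →
                         _≡_ {A = CyclicWord R} (_ , w) (_ , w′)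
  cyclicWord-injective (s , w) (s′ , w′) eq
    with refl ← trans (sym (letter-last w)) (trans (cong isFwd (eq (fromℕ n))) (letter-last w′)) =
    cong (s ,_) (letter-injective w w′ eq)

  edgeSet-cong : ∀ {ℓ ℓ′} → ℓ ≗ ℓ′ → edgeSet ℓ ≡ edgeSet ℓ′
  edgeSet-cong {ℓ} {ℓ′} eq = tabulate-cong λ e → bit (splitAt N e)
    where
    bit : ∀ x → edgeBit ℓ x ≡ edgeBit ℓ′ x
    bit (inj₁ i) = cong₂ (λ x y → isFwd x ∨ isBwd y) (eq i) (eq (next i))
    bit (inj₂ i) = cong isSpoke (eq i)

  -- From valid letters to a rooted forest.

  module _ {R : Subset N} {ℓ : Fin N → Letter} (R≢∅ : Nonempty R) (valid : Valid R ℓ) where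
    open Valid valid
    private
      Ancestral : Vertex → Set
      Ancestral x = ∃ λ s → s ∈ center∪ R × Star (Parent ℓ) x s

      step : ∀ {x y} → Parent ℓ x y → Ancestral y → Ancestral x
      step p (s , s∈ , ps) = s , s∈ , p ◅ ps

      at-root : ∀ {x} → x ∈ center∪ R → Ancestral x
      at-root {x} x∈ = x , x∈ , ε

    -- After a `fwd`, `noClash` excludes `bwd` on the next vertex, so the direction never changes;
    -- the walk stops at a spoke or a root, at the latest at r.
    reaches-forward : ∀ {i r} → r ∈ R → Star (λ i j → next i ≡ j) i r → ℓ i ≢ bwd → Ancestral (suc i)
    reaches-forward r∈R ε _ = at-root (rim∈⁺ r∈R)
    reaches-forward {i} r∈R (refl ◅ ps) i≢bwd with ℓ i in eq
    ... | root  = at-root (rim∈⁺ (root⇒∈ i eq))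
    ... | spoke = step (spoke eq) (at-root center∈)
    ... | fwd   = step (fwd eq refl) (reaches-forward r∈R ps (noClash i eq))
    ... | bwd   = ⊥-elim (i≢bwd refl)

    reaches-backward : ∀ {i r} → r ∈ R → Star (λ i j → next j ≡ i) i r → ℓ i ≢ fwd → Ancestral (suc i)
    reaches-backward r∈R ε _ = at-root (rim∈⁺ r∈R)
    reaches-backward {i} r∈R (_◅_ {j = j} refl ps) i≢fwd with ℓ i in eq
    ... | root  = at-root (rim∈⁺ (root⇒∈ i eq))
    ... | spoke = step (spoke eq) (at-root center∈)
    ... | fwd   = ⊥-elim (i≢fwd refl)
    ... | bwd   = step (bwd eq refl) (reaches-backward r∈R ps λ j≡fwd → noClash j j≡fwd eq)

    reaches-root : ∀ x → Ancestral x
    reaches-root zero = at-root center∈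
    reaches-root (suc i) with ℓ i in eq
    ... | root  = at-root (rim∈⁺ (root⇒∈ i eq))
    ... | spoke = step (spoke eq) (at-root center∈)
    ... | fwd   = reaches-forward (proj₂ R≢∅) (cyclic i (proj₁ R≢∅))
                    λ i≡bwd → case trans (sym eq) i≡bwd of λ ()
    ... | bwd   = reaches-backward (proj₂ R≢∅) (reverse (λ p → p) (cyclic (proj₁ R≢∅) i))
                    λ i≡fwd → case trans (sym eq) i≡fwd of λ ()

    isParentRelation : IsParentRelation W (center∪ R) (edgeSet ℓ) (Parent ℓ)
    isParentRelation = record
      { functional = functional
      ; root       = no-parent
      ; adjacent   = adjacent
      ; oriented   = oriented
      ; reaches    = reaches-root
      }
      where
      clash : ∀ {x y : Letter} {i} → ℓ i ≡ x → ℓ i ≡ y → x ≡ y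
      clash p q = trans (sym p) q

      functional : ∀ {x y z} → Parent ℓ x y → Parent ℓ x z → y ≡ z
      functional (spoke _)   (spoke _)    = refl
      functional (fwd _ p)   (fwd _ q)    = cong suc (trans (sym p) q)
      functional (bwd _ p)   (bwd _ q)    = cong suc (next-injective (trans p (sym q)))
      functional (spoke p)   (fwd q _) with () ← clash p q
      functional (spoke p)   (bwd q _) with () ← clash p q
      functional (fwd p _)   (spoke q) with () ← clash p q
      functional (fwd p _)   (bwd q _) with () ← clash p q
      functional (bwd p _)   (spoke q) with () ← clash p q
      functional (bwd p _)   (fwd q _) with () ← clash p q

      no-parent : ∀ {x y} → x ∈ center∪ R → ¬ Parent ℓ x y
      no-parent x∈ (spoke p) with () ← clash (∈⇒root _ (rim∈⁻ x∈)) p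
      no-parent x∈ (fwd p _) with () ← clash (∈⇒root _ (rim∈⁻ x∈)) p
      no-parent x∈ (bwd p _) with () ← clash (∈⇒root _ (rim∈⁻ x∈)) p

      adjacent : ∀ {x y} → Parent ℓ x y → Adjacent (edgeSet ℓ) x y
      adjacent (spoke {i} p)            = N ↑ʳ i , spoke⇒∈edgeSet ℓ i p , joins-spoke i
      adjacent (fwd {i} p refl)         = i ↑ˡ N , fwd⇒∈edgeSet ℓ i p , joins-rim i
      adjacent (bwd {j = j} p refl) = j ↑ˡ N , bwd⇒∈edgeSet ℓ j p , swap (joins-rim j)

      oriented : ∀ {x y} → Adjacent (edgeSet ℓ) x y → Parent ℓ x y ⊎ Parent ℓ y x
      oriented (e , e∈ , j) with edgeView e
      oriented (_ , e∈ , j) | rim i with rim∈edgeSet⁻ ℓ i e∈ | rim-ends i j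
      ... | inj₁ p | inj₁ (refl , refl) = inj₁ (fwd p refl)
      ... | inj₁ p | inj₂ (refl , refl) = inj₂ (fwd p refl)
      ... | inj₂ p | inj₁ (refl , refl) = inj₂ (bwd p refl)
      ... | inj₂ p | inj₂ (refl , refl) = inj₁ (bwd p refl)
      oriented (_ , e∈ , j) | spoke i with spoke∈edgeSet⁻ ℓ i e∈ | spoke-ends i j
      ... | p | inj₁ (refl , refl) = inj₂ (spoke p)
      ... | p | inj₂ (refl , refl) = inj₁ (spoke p)

  -- The edge set determines the parent relation by `parent-unique`, and the parent of a vertex
  -- determines its letter by `next²≢`.
  edgeSet-injective : ∀ {R ℓ ℓ′} → Nonempty R → Valid R ℓ → Valid R ℓ′ → edgeSet ℓ ≡ edgeSet ℓ′ → ℓ ≗ ℓ′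
  edgeSet-injective {R} {ℓ} {ℓ′} R≢∅ valid valid′ eq i = agree (ℓ i) refl
    where
    same-parent : ∀ {x y} → Parent ℓ x y → Parent ℓ′ x y
    same-parent = parent-unique W (isParentRelation R≢∅ valid)
      (subst (λ T → IsParentRelation W (center∪ R) T (Parent ℓ′)) (sym eq) (isParentRelation R≢∅ valid′))

    agree : ∀ x → ℓ i ≡ x → x ≡ ℓ′ i
    agree root  p = sym (Valid.∈⇒root valid′ i (Valid.root⇒∈ valid i p))
    agree spoke p with same-parent (spoke p)
    ... | spoke q = sym q
    agree fwd p with same-parent (fwd p refl)
    ... | fwd q _ = sym q
    ... | bwd _ q = ⊥-elim (next²≢ i q)
    agree bwd p with prev i
    ... | j , refl with same-parent (bwd p refl)
    ...   | bwd q _ = sym q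
    ...   | fwd _ q = ⊥-elim (next²≢ j q)

  -- From a rooted forest back to valid letters.

  module _ {R : Subset N} {T : SpanningSubgraph} (forest : IsRootedSpanningForest (center∪ R) T) where

    -- The rim letters carry an escape as evidence against mutual pairs; a spoke takes part in no
    -- such pair and carries only its edge.
    data Chosen (i : Fin N) : Letter → Set where
      root  : i ∈ R → Chosen i root
      spoke : i ∉ R → N ↑ʳ i ∈ T → Chosen i spoke
      fwd   : ∀ {j} → i ∉ R → next i ≡ j → i ↑ˡ N ∈ T → Escapes W (center∪ R) T (suc i) (suc j) → Chosen i fwd
      bwd   : ∀ {j} → i ∉ R → next j ≡ i → j ↑ˡ N ∈ T → Escapes W (center∪ R) T (suc i) (suc j) → Chosen i bwd

    choose : ∀ i → ∃ (Chosen i)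
    choose i with i ∈? R
    ... | yes i∈R = _ , root i∈R
    ... | no  i∉R with escape W forest (i∉R ∘ rim∈⁻)
    ...   | x , (e , e∈T , j) , esc with edgeView e
    ...     | spoke k with spoke-ends k j
    ...       | inj₂ (refl , refl) = _ , spoke i∉R e∈T
    choose i | no i∉R | x , (e , e∈T , j) , esc | rim k with rim-ends k j
    ...       | inj₁ (refl , refl) = _ , fwd i∉R refl e∈T esc
    ...       | inj₂ (refl , refl) = _ , bwd i∉R refl e∈T esc

    pointer : Fin N → Letter
    pointer i = proj₁ (choose i)

    pointer-chosen : ∀ {i x} → pointer i ≡ x → Chosen i x
    pointer-chosen {i} refl = proj₂ (choose i)

    pointer-valid : Valid R pointer
    pointer-valid = record { root⇒∈ = root⇒∈ ; ∈⇒root = ∈⇒root ; noClash = noClash }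
      where
      root⇒∈ : ∀ i → pointer i ≡ root → i ∈ R
      root⇒∈ i eq with pointer-chosen eq
      ... | root i∈R = i∈R

      ∈⇒root : ∀ i → i ∈ R → pointer i ≡ root
      ∈⇒root i i∈R with choose i
      ... | _ , root _        = refl
      ... | _ , spoke i∉R _   = ⊥-elim (i∉R i∈R)
      ... | _ , fwd i∉R _ _ _ = ⊥-elim (i∉R i∈R)
      ... | _ , bwd i∉R _ _ _ = ⊥-elim (i∉R i∈R)

      noClash : ∀ i → pointer i ≡ fwd → pointer (next i) ≢ bwd
      noClash i p q with pointer-chosen p | pointer-chosen q
      ... | fwd _ refl i∈T esc | bwd {j} _ r _ esc′ with refl ← next-injective {j} {i} r =
        no-mutual-escape W forest i∈T (joins-rim i) esc esc′

    pointer-edges⊆ : edgeSet pointer ⊆ T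
    pointer-edges⊆ {e} e∈ with edgeView e
    ... | spoke i with pointer-chosen (spoke∈edgeSet⁻ pointer i e∈)
    ...   | spoke _ i∈T = i∈T
    pointer-edges⊆ {e} e∈ | rim i with rim∈edgeSet⁻ pointer i e∈
    ...   | inj₁ p with pointer-chosen p
    ...     | fwd _ _ i∈T _ = i∈T
    pointer-edges⊆ {e} e∈ | rim i | inj₂ p with pointer-chosen p
    ...     | bwd {j} _ q j∈T _ with refl ← next-injective {j} {i} q = j∈T

    -- Since the pointers are valid, following them leads every vertex to a root inside
    -- `edgeSet pointer`; a subgraph of T with this property is all of T.
    edgeSet-pointer : Nonempty R → edgeSet pointer ≡ T
    edgeSet-pointer R≢∅ = spanning-⊆⇒≡ W forest pointer-edges⊆ λ v →
      let s , s∈ , ps = reaches v in s , s∈ , Star-map adjacent ps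
      where open IsParentRelation (isParentRelation R≢∅ pointer-valid) using (reaches; adjacent)

  forestBijection : ∀ {R : Subset N} → Nonempty R →
                    Bijection (setoid (CyclicWord R)) (RootedSpanningForests W (center∪ R))
  forestBijection {R} R≢∅ = record
    { to        = λ (_ , w) → edgeSet (letter w) ,
                    IsParentRelation.isRootedSpanningForest (isParentRelation R≢∅ (letter-valid w))
    ; cong      = λ { refl → refl }
    ; bijective =
        (λ {(_ , w)} {(_ , w′)} eq → cyclicWord-injective (_ , w) (_ , w′)
          (edgeSet-injective R≢∅ (letter-valid w) (letter-valid w′) eq)) ,
        λ (T , forest) → let w , w≗ = valid-spell (pointer-valid forest) in
          w , λ { refl → trans (edgeSet-cong w≗) (edgeSet-pointer forest R≢∅) }
    }

positive-size⇒nonempty : ∀ {n} (R : Subset n) → 1 ≤ ∣ R ∣ → Nonempty R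
positive-size⇒nonempty {n} R 1≤∣R∣ with nonempty? R
... | yes R≢∅ = R≢∅
... | no  R≡∅ with refl ← Empty-unique R≡∅ = contradiction (subst (1 ≤_) (∣⊥∣≡0 n) 1≤∣R∣) λ ()

theorem1p2 : (N r : ℕ) (N≥3 : N ≥ 3) → 1 ≤ r → r ≤ N →
    (R : Subset N) → ∣ R ∣ ≡ r →
    𝓕 (wheel N N≥3) [ center∪ R ]≐ product (map (λ d → fib (2 * d)) (cyclicIntervals R))
theorem1p2 (suc n) _ N≥3 1≤r _ R refl =
  subst (HasCardinality _) (cyclicCount≡product R R≢∅)
    (inverse (cyclicCount↔CyclicWord R) (Bijection⇒Inverse (forestBijection n N≥3 R≢∅)))
  where
  R≢∅ : Nonempty R
  R≢∅ = positive-size⇒nonempty R 1≤r
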